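{- Let $\mathbf A$ be a finite solvable Malcev algebra. Then $\mathrm{nuP}_{\mathbf A}\subseteq\mathsf{NC}^2$.
   Context: $\mathsf{NC}^2$ is the (non-uniform) class of languages recognized by polynomial-size, depth-$O(\log^2 n)$ Boolean circuits with fan-in-2 $\wedge,\vee$ and $\neg$ gates. For a finite algebra $\mathbf A$, $\mathrm{nuP}_{\mathbf A}$ is the class of languages over $\{0,1\}$ recognized by NuDFAs $((t_n),\iota,S)$: $t_n$ is an $n$-input circuit over $\mathbf A$ (DAG with sources labelled by variables or constants of $A$, gates labelled by basic operations) of size polynomial in $n$, $\iota:\{0,1\}\to A$, $S\subseteq A$, and $b\in\{0,1\}^n$ is accepted iff $t_n(\iota(b_1),\dots,\iota(b_n))\in S$. Malcev: has a term $d$ with $d(x,y,y)=d(y,y,x)=x$; solvable in the commutator-theory sense. -}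

module Defs where

open import Data.Nat using (ℕ; zero; suc; _+_; _*_; _^_; _≤_; _⊔_)
open import Data.Nat.Logarithm using (⌊log₂_⌋)
open import Data.Fin using (Fin; zero; suc)
open import Data.Fin.Subset using (Subset; _∈_)
open import Data.Bool using (Bool; true; false; _∧_; _∨_; not)
open import Data.Vec using (Vec; lookup)
open import Data.Sum using (_⊎_; inj₁; inj₂; [_,_])
open import Data.Product using (Σ; ∃; ∃-syntax; _×_; _,_)
open import Data.Unit using (⊤)
open import Relation.Binary.PropositionalEquality using (_≡_)

record FinAlgebra : Set where
  field
    size   : ℕ
    nOps   : ℕ
    arity  : Fin nOps → ℕ
    op     : (f : Fin nOps) → (Fin (arity f) → Fin size) → Fin size

module _ (𝔸 : FinAlgebra) where
  open FinAlgebra 𝔸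

  data Term (V : Set) : Set where
    var : V → Term V
    app : (f : Fin nOps) → (Fin (arity f) → Term V) → Term V

  ⟦_⟧ : {V : Set} → Term V → (V → Fin size) → Fin size
  ⟦ var x ⟧ ρ    = ρ x
  ⟦ app f ts ⟧ ρ = op f (λ j → ⟦ ts j ⟧ ρ)

  IsMalcev : Set
  IsMalcev = ∃[ d ] (∀ x y →
      ⟦ d ⟧ (triple x y y) ≡ x × ⟦ d ⟧ (triple y y x) ≡ x)
    where
      triple : Fin size → Fin size → Fin size → Fin 3 → Fin size
      triple a b c zero             = a
      triple a b c (suc zero)       = b
      triple a b c (suc (suc zero)) = c

  Rel₀ : Set₁
  Rel₀ = Fin size → Fin size → Set

  BRel : Set
  BRel = Fin size → Fin size → Bool

  -- δ is a congruence of 𝔸 (Bool-valued relation; on a finite set every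
  -- relation is of this form)
  record IsCongruence (δ : BRel) : Set where
    field
      refl′  : ∀ a → δ a a ≡ true
      sym′   : ∀ a b → δ a b ≡ true → δ b a ≡ true
      trans′ : ∀ a b c → δ a b ≡ true → δ b c ≡ true → δ a c ≡ true
      compat : ∀ (f : Fin nOps) (a b : Fin (arity f) → Fin size) →
               (∀ i → δ (a i) (b i) ≡ true) → δ (op f a) (op f b) ≡ true

  TC : Rel₀ → Rel₀ → BRel → Set
  TC α β δ = ∀ (p q : ℕ) (t : Term (Fin p ⊎ Fin q))
               (a b : Fin p → Fin size) (c d : Fin q → Fin size) →
               (∀ i → α (a i) (b i)) → (∀ j → β (c j) (d j)) →
               δ (⟦ t ⟧ [ a , c ]) (⟦ t ⟧ [ a , d ]) ≡ true →
               δ (⟦ t ⟧ [ b , c ]) (⟦ t ⟧ [ b , d ]) ≡ true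

  -- Commutator [α,β]: the least congruence δ with C(α,β;δ)
  -- (the intersection of all such congruences)
  Comm : Rel₀ → Rel₀ → Rel₀
  Comm α β x y = ∀ (δ : BRel) → IsCongruence δ → TC α β δ → δ x y ≡ true

  derived : ℕ → Rel₀
  derived zero    _ _ = ⊤
  derived (suc k) = Comm (derived k) (derived k)

  IsSolvable : Set
  IsSolvable = ∃[ k ] (∀ x y → derived k x y → x ≡ y)

Language : Set₁
Language = (n : ℕ) → Vec Bool n → Set

PolyBounded : (ℕ → ℕ) → Set
PolyBounded s = ∃[ c ] (∀ n → s n ≤ c * n ^ c + c)

-- Circuits over a finite algebra, as straight-line programs (topologically
-- sorted DAGs). A node added to a circuit with k nodes may refer to any of
-- the k earlier nodes; index zero is the most recently added node.

module _ (𝔸 : FinAlgebra) where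
  open FinAlgebra 𝔸

  data AGate (n k : ℕ) : Set where
    avar   : Fin n → AGate n k
    aconst : Fin size → AGate n k
    aop    : (f : Fin nOps) → (Fin (arity f) → Fin k) → AGate n k

  data ACirc (n : ℕ) : ℕ → Set where
    []  : ACirc n 0
    _▷_ : ∀ {k} → ACirc n k → AGate n k → ACirc n (suc k)

  aGateVal : ∀ {n k} → AGate n k → (Fin n → Fin size) → (Fin k → Fin size) → Fin size
  aGateVal (avar i)   ρ v = ρ i
  aGateVal (aconst a) ρ v = a
  aGateVal (aop f js) ρ v = op f (λ j → v (js j))

  aValues : ∀ {n k} → ACirc n k → (Fin n → Fin size) → Fin k → Fin size
  aValues (C ▷ g) ρ zero    = aGateVal g ρ (aValues C ρ)
  aValues (C ▷ g) ρ (suc j) = aValues C ρ j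

  aOut : ∀ {n s} → ACirc n (suc s) → (Fin n → Fin size) → Fin size
  aOut C ρ = aValues C ρ zero

  -- nuP_A: recognized by a NuDFA ((t_n), ι, S) with t_n of polynomial size
  -- (size = number of nodes)
  nuP : Language → Set
  nuP L = Σ (ℕ → ℕ) λ s → Σ ((n : ℕ) → ACirc n (suc (s n))) λ t →
          Σ (Bool → Fin size) λ ι → Σ (Subset size) λ S →
            PolyBounded (λ n → suc (s n)) ×
            (∀ n (b : Vec Bool n) →
               (L n b → aOut (t n) (λ i → ι (lookup b i)) ∈ S) ×
               (aOut (t n) (λ i → ι (lookup b i)) ∈ S → L n b))

data BGate (n k : ℕ) : Set where
  bvar   : Fin n → BGate n k
  bconst : Bool → BGate n k
  band   : Fin k → Fin k → BGate n k
  bor    : Fin k → Fin k → BGate n k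
  bnot   : Fin k → BGate n k

data BCirc (n : ℕ) : ℕ → Set where
  []  : BCirc n 0
  _▷_ : ∀ {k} → BCirc n k → BGate n k → BCirc n (suc k)

bGateVal : ∀ {n k} → BGate n k → (Fin n → Bool) → (Fin k → Bool) → Bool
bGateVal (bvar i)   ρ v = ρ i
bGateVal (bconst b) ρ v = b
bGateVal (band i j) ρ v = v i ∧ v j
bGateVal (bor i j)  ρ v = v i ∨ v j
bGateVal (bnot i)   ρ v = not (v i)

bValues : ∀ {n k} → BCirc n k → (Fin n → Bool) → Fin k → Bool
bValues (C ▷ g) ρ zero    = bGateVal g ρ (bValues C ρ)
bValues (C ▷ g) ρ (suc j) = bValues C ρ j

bGateDepth : ∀ {n k} → BGate n k → (Fin k → ℕ) → ℕ
bGateDepth (bvar i)   d = 0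
bGateDepth (bconst b) d = 0
bGateDepth (band i j) d = suc (d i ⊔ d j)
bGateDepth (bor i j)  d = suc (d i ⊔ d j)
bGateDepth (bnot i)   d = suc (d i)

bDepths : ∀ {n k} → BCirc n k → Fin k → ℕ
bDepths (C ▷ g) zero    = bGateDepth g (bDepths C)
bDepths (C ▷ g) (suc j) = bDepths C j

bOut : ∀ {n s} → BCirc n (suc s) → (Fin n → Bool) → Bool
bOut C ρ = bValues C ρ zero

bDepth : ∀ {n s} → BCirc n (suc s) → ℕ
bDepth C = bDepths C zero

NC2 : Language → Set
NC2 L = Σ (ℕ → ℕ) λ s → Σ ((n : ℕ) → BCirc n (suc (s n))) λ C →
          PolyBounded (λ n → suc (s n)) ×
          (∃[ c ] (∀ n → bDepth (C n) ≤ c * (⌊log₂ n ⌋ ^ 2) + c)) ×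
          (∀ n (b : Vec Bool n) →
             (L n b → bOut (C n) (λ i → lookup b i) ≡ true) ×
             (bOut (C n) (λ i → lookup b i) ≡ true → L n b))

{-# OPTIONS --safe #-}

-- The gate values v of an algebra circuit are recovered modulo the terms of
-- the derived series 1 = α₀ ≥ α₁ ≥ … ≥ α_K = 0, one term at a time.  Suppose z
-- agrees with v modulo α = α_k, and let δ = α_{k+1} = [α,α].  Let T be the map
-- that recomputes all gates simultaneously from a vector of values; T^m(z) = v
-- once m is at least the number of gates.  By the term condition the Malcev
-- term d satisfies F(d(x,z,y)) ≡ d(F(x),F(z),F(y)) mod δ for F = T^m and x, y
-- in the α-class of z, so modulo δ the vector F(x) is a balanced d-tree over
-- the values of F at the points z[j := xⱼ], which differ from z in one
-- coordinate.  Hence the polynomially large table of T^m at such points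
-- determines the table of T^{2m} through trees of depth O(log n), and O(log n)
-- squarings give v modulo δ.  In total this is O(log n) layers, each of
-- Boolean depth O(log n).
module Submission where

open import Defs
open import Data.Nat
open import Data.Nat.Properties
open import Data.Nat.Induction using (<-wellFounded)
open import Data.Nat.Logarithm using (⌊log₂_⌋)
open import Data.Nat.Logarithm.Core using (⌊log2⌋)
open import Data.Nat.Tactic.RingSolver using (solve-∀)
open import Data.Fin using (Fin; zero; suc; toℕ; fromℕ<; splitAt; _↑ˡ_; _↑ʳ_)
import Data.Fin.Properties as Fin
open import Data.Fin.Subset using (Subset)
open import Data.Bool using (Bool; true; false; _∧_; _∨_; not; if_then_else_)
open import Data.Bool.Properties using (∨-identityʳ; ∨-idem)
open import Data.Empty using (⊥; ⊥-elim)
open import Data.Maybe using (Maybe; just; nothing)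
open import Data.Product using (∃; _×_; _,_; proj₁; proj₂)
open import Data.Product.Function.NonDependent.Propositional using (_×-↔_)
open import Data.Sum using (_⊎_; inj₁; inj₂; [_,_])
open import Data.Unit using (⊤; tt)
open import Data.Vec using (Vec; []; _∷_; lookup; tabulate)
open import Data.Vec.Properties using (lookup∘tabulate; []=⇒lookup; lookup⇒[]=)
open import Data.Vec.Functional using (_++_)
open import Data.Vec.Functional.Properties using (lookup-++ˡ; lookup-++ʳ)
open import Function using (_∘_; _↔_; Inverse; mk↔ₛ′)
open import Function.Construct.Composition using (_↔-∘_)
open import Function.Construct.Identity using (↔-id)
open import Induction.WellFounded using (Acc; acc)
open import Relation.Nullary using (yes; no; does)
open import Relation.Binary.PropositionalEquality hiding ([_])

-- Relaxation of algebra circuits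

-- Balanced ternary tree over the leaves o, …, o + 2ʰ − 1, with the base at
-- every middle position and at the leaf positions outside Fin s.
foldTree : {X : Set} → (X → X → X → X) → ∀ {s} → ℕ → ℕ → (Fin s → X) → X → X
foldTree d {s} zero o leaf base with o <? s
... | yes o<s = leaf (fromℕ< o<s)
... | no _    = base
foldTree d (suc h) o leaf base =
  d (foldTree d h o leaf base) base (foldTree d h (o + 2 ^ h) leaf base)

-- Parametricity of the tree. It serves twice: for values against the vectors they are computed
-- from, and for Boolean words against the values they encode. The middle argument is always the
-- base, so `d` and `e` are compared only there.
foldTree-rel : {X Y : Set} (R : X → Y → Set) {d : X → X → X → X} {e : Y → Y → Y → Y} →
  ∀ {s} {leaf : Fin s → X} {leaf′ : Fin s → Y} {base base′} →
  (∀ {x x′ y y′} → R x x′ → R y y′ → R (d x base y) (e x′ base′ y′)) →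
  (∀ k → R (leaf k) (leaf′ k)) → R base base′ →
  ∀ h o → R (foldTree d h o leaf base) (foldTree e h o leaf′ base′)
foldTree-rel R {s = s} d∼e leaf∼ base∼ zero o with o <? s
... | yes o<s = leaf∼ (fromℕ< o<s)
... | no _    = base∼
foldTree-rel R d∼e leaf∼ base∼ (suc h) o =
  d∼e (foldTree-rel R d∼e leaf∼ base∼ h o)
      (foldTree-rel R d∼e leaf∼ base∼ h (o + 2 ^ h))

iterate : {X : Set} → (X → X) → ℕ → X → X
iterate f zero    x = x
iterate f (suc n) x = f (iterate f n x)

iterate-+ : {X : Set} (f : X → X) → ∀ m n x →
  iterate f (m + n) x ≡ iterate f m (iterate f n x)
iterate-+ f zero    n x = refl
iterate-+ f (suc m) n x = cong f (iterate-+ f m n x)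

-- Codes for the vectors that differ from a base vector in at most one coordinate. There are
-- `1 + s * size` of them when `A` is the carrier, which keeps a table indexed by them polynomial.
Point : ℕ → Set → Set
Point s A = Maybe (Fin s × A)

perturb : ∀ {s} {A : Set} → (Fin s → A) → Point s A → Fin s → A
perturb z nothing        k = z k
perturb z (just (j , x)) k = if does (k Fin.≟ j) then x else z k

-- Congruences, the derived series and the Malcev operation

module Congruences (𝔸 : FinAlgebra) where
  open FinAlgebra 𝔸

  A : Set
  A = Fin size

  -- Set-valued, so as to cover `derived 𝔸 k`, which is an intersection of Boolean congruences and
  -- comes with no decision procedure.
  record Congruence (_≈_ : A → A → Set) : Set where
    field
      reflexive  : ∀ {x} → x ≈ x
      symmetric  : ∀ {x y} → x ≈ y → y ≈ x
      transitive : ∀ {x y z} → x ≈ y → y ≈ z → x ≈ z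
      compatible : ∀ f {a b : Fin (arity f) → A} → (∀ i → a i ≈ b i) → op f a ≈ op f b

    ≡⇒≈ : ∀ {x y} → x ≡ y → x ≈ y
    ≡⇒≈ refl = reflexive

    term-cong : {V : Set} (t : Term 𝔸 V) {ρ σ : V → A} →
      (∀ v → ρ v ≈ σ v) → ⟦_⟧ 𝔸 t ρ ≈ ⟦_⟧ 𝔸 t σ
    term-cong (var x)    ρ≈σ = ρ≈σ x
    term-cong (app f ts) ρ≈σ = compatible f (λ i → term-cong (ts i) ρ≈σ)

    gate-cong : ∀ {n k} (g : AGate 𝔸 n k) ρ {x y : Fin k → A} →
      (∀ i → x i ≈ y i) → aGateVal 𝔸 g ρ x ≈ aGateVal 𝔸 g ρ y
    gate-cong (avar i)   ρ x≈y = reflexive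
    gate-cong (aconst a) ρ x≈y = reflexive
    gate-cong (aop f js) ρ x≈y = compatible f (x≈y ∘ js)

  open Congruence

  bool-congruence : ∀ {δ} → IsCongruence 𝔸 δ → Congruence (λ x y → δ x y ≡ true)
  bool-congruence c .reflexive      = IsCongruence.refl′ c _
  bool-congruence c .symmetric      = IsCongruence.sym′ c _ _
  bool-congruence c .transitive     = IsCongruence.trans′ c _ _ _
  bool-congruence c .compatible f p = IsCongruence.compat c f _ _ p

  derived-congruence : ∀ k → Congruence (derived 𝔸 k)
  derived-congruence zero = record
    { reflexive = tt ; symmetric = λ _ → tt ; transitive = λ _ _ → tt ; compatible = λ _ _ → tt }
  derived-congruence (suc k) .reflexive δ c tc        = bool-congruence c .reflexive
  derived-congruence (suc k) .symmetric p δ c tc      = bool-congruence c .symmetric (p δ c tc)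
  derived-congruence (suc k) .transitive p q δ c tc   =
    bool-congruence c .transitive (p δ c tc) (q δ c tc)
  derived-congruence (suc k) .compatible f p δ c tc   =
    bool-congruence c .compatible f (λ i → p i δ c tc)

  -- The commutator is monotone: the term condition for larger relations implies it for smaller
  -- ones, so the intersection defining the later term runs over at least as many `δ`.
  derived-decreasing : ∀ k {x y} → derived 𝔸 (suc k) x y → derived 𝔸 k x y
  derived-decreasing zero    _         = tt
  derived-decreasing (suc k) p δ c tc  = p δ c λ r q t a b u v α β →
    tc r q t a b u v (derived-decreasing k ∘ α) (derived-decreasing k ∘ β)

  -- Without function extensionality, that basic operations respect pointwise
  -- equality of their arguments has to be extracted from solvability.
  op-cong : IsSolvable 𝔸 → ∀ f {a b : Fin (arity f) → A} → (∀ i → a i ≡ b i) → op f a ≡ op f b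
  op-cong (k , derived⊆≡) f a≡b = derived⊆≡ _ _
    (compatible (derived-congruence k) f (≡⇒≈ (derived-congruence k) ∘ a≡b))

  module Malcev (malcev : IsMalcev 𝔸) where

    d-term : Term 𝔸 (Fin 3)
    d-term = proj₁ malcev

    d : A → A → A → A
    d x y z = ⟦_⟧ 𝔸 d-term (lookup (x ∷ y ∷ z ∷ []))

    module _ {_≈_ : A → A → Set} (cong-≈ : Congruence _≈_) where
      private module C = Congruence cong-≈

      d-cong : ∀ {x x′ y y′ z z′} → x ≈ x′ → y ≈ y′ → z ≈ z′ → d x y z ≈ d x′ y′ z′
      d-cong p q r = C.term-cong d-term λ { zero → p ; (suc zero) → q ; (suc (suc zero)) → r }

      d-right : ∀ x y → d x y y ≈ x
      d-right x y = C.transitive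
        -- The valuation in `IsMalcev` agrees with `lookup` only pointwise; `term-cong` passes from
        -- one to the other.
        (C.term-cong d-term λ
          { zero → C.reflexive ; (suc zero) → C.reflexive ; (suc (suc zero)) → C.reflexive })
        (C.≡⇒≈ (proj₁ (proj₂ malcev x y)))

      d-left : ∀ x y → d y y x ≈ x
      d-left x y = C.transitive
        (C.term-cong d-term λ
          { zero → C.reflexive ; (suc zero) → C.reflexive ; (suc (suc zero)) → C.reflexive })
        (C.≡⇒≈ (proj₂ (proj₂ malcev x y)))

    subst-term : {V W : Set} → Term 𝔸 V → (V → Term 𝔸 W) → Term 𝔸 W
    subst-term (var x)    σ = σ x
    subst-term (app f ts) σ = app f (λ i → subst-term (ts i) σ)

    d-app : {V : Set} → Term 𝔸 V → Term 𝔸 V → Term 𝔸 V → Term 𝔸 V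
    d-app t u v = subst-term d-term (lookup (t ∷ u ∷ v ∷ []))

    -- The substitution lemma modulo a congruence; compatibility of `R` stands in for function
    -- extensionality under `op f`.
    subst-eval : ∀ {R} → Congruence R → {V W : Set} (t : Term 𝔸 V) (σ : V → Term 𝔸 W)
      {τ : V → A} (ρ : W → A) →
      (∀ v → R (⟦_⟧ 𝔸 (σ v) ρ) (τ v)) → R (⟦_⟧ 𝔸 (subst-term t σ) ρ) (⟦_⟧ 𝔸 t τ)
    subst-eval C (var x)    σ ρ h = h x
    subst-eval C (app f ts) σ ρ h = compatible C f (λ i → subst-eval C (ts i) σ ρ h)

    d-app-eval : ∀ {R} → Congruence R → {V : Set} (t u v : Term 𝔸 V) (ρ : V → A) {x y z : A} →
      R (⟦_⟧ 𝔸 t ρ) x → R (⟦_⟧ 𝔸 u ρ) y → R (⟦_⟧ 𝔸 v ρ) z →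
      R (⟦_⟧ 𝔸 (d-app t u v) ρ) (d x y z)
    d-app-eval C t u v ρ p q r = subst-eval C d-term _ ρ
      λ { zero → p ; (suc zero) → q ; (suc (suc zero)) → r }

    -- Apply the term condition to d(f(d(u,z,v)), f(v), f(w)): at u = z both
    -- (v,w) = (y,y) and (v,w) = (z,y) give f(y); move u from z to x.
    op-affine-δ : ∀ {α : A → A → Set} {δ} → Congruence α → IsCongruence 𝔸 δ → TC 𝔸 α α δ →
      ∀ f (x z y : Fin (arity f) → A) → (∀ i → α (x i) (z i)) → (∀ i → α (y i) (z i)) →
      δ (op f (λ i → d (x i) (z i) (y i))) (d (op f x) (op f z) (op f y)) ≡ true
    op-affine-δ {α} {δ} αC c tc f x z y x∼z y∼z =
      C.transitive (C.symmetric at-xy) (C.transitive moved at-xz)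
      where
      r = arity f
      C = bool-congruence c
      module C = Congruence C
      _≈_ : A → A → Set
      s ≈ t = δ s t ≡ true

      u v w z′ : Fin r → Term 𝔸 (Fin r ⊎ Fin (r + (r + r)))
      u i  = var (inj₁ i)
      z′ i = var (inj₂ (i ↑ˡ (r + r)))
      v i  = var (inj₂ (r ↑ʳ (i ↑ˡ r)))
      w i  = var (inj₂ (r ↑ʳ (r ↑ʳ i)))

      t = d-app (app f (λ i → d-app (u i) (z′ i) (v i))) (app f v) (app f w)

      params : (Fin r → A) → Fin (r + (r + r)) → A
      params b = z ++ (b ++ y)

      t-eval : ∀ a b → ⟦_⟧ 𝔸 t [ a , params b ] ≈
        d (op f (λ i → d (a i) (z i) (b i))) (op f b) (op f y)
      t-eval a b = d-app-eval C (app f (λ i → d-app (u i) (z′ i) (v i))) (app f v) (app f w) _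
        (C.compatible f λ i →
          d-app-eval C (u i) (z′ i) (v i) _ C.reflexive (C.≡⇒≈ z-eval) (C.≡⇒≈ (v-eval i)))
        (C.compatible f (C.≡⇒≈ ∘ v-eval))
        (C.compatible f (λ i → C.≡⇒≈ (trans (lookup-++ʳ z (b ++ y) (r ↑ʳ i)) (lookup-++ʳ b y i))))
        where
        z-eval : ∀ {i} → params b (i ↑ˡ (r + r)) ≡ z i
        z-eval {i} = lookup-++ˡ z (b ++ y) i
        v-eval : ∀ i → params b (r ↑ʳ (i ↑ˡ r)) ≡ b i
        v-eval i = trans (lookup-++ʳ z (b ++ y) (i ↑ˡ r)) (lookup-++ˡ b y i)

      at-z : ∀ b → ⟦_⟧ 𝔸 t [ z , params b ] ≈ op f y
      at-z b = C.transitive (t-eval z b) (C.transitive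
        (d-cong C (C.compatible f (λ i → d-left C (b i) (z i))) C.reflexive C.reflexive)
        (d-left C (op f y) (op f b)))

      ++-related : ∀ {m n} (a a′ : Fin m → A) (b b′ : Fin n → A) →
        (∀ i → α (a i) (a′ i)) → (∀ i → α (b i) (b′ i)) → ∀ i → α ((a ++ b) i) ((a′ ++ b′) i)
      ++-related {m} a a′ b b′ p q i with splitAt m i
      ... | inj₁ j = p j
      ... | inj₂ j = q j

      moved : ⟦_⟧ 𝔸 t [ x , params y ] ≈ ⟦_⟧ 𝔸 t [ x , params z ]
      moved = tc r (r + (r + r)) t z x (params y) (params z)
        (symmetric αC ∘ x∼z)
        (++-related z z (y ++ y) (z ++ y) (λ _ → reflexive αC)
          (++-related y z y y y∼z (λ _ → reflexive αC)))
        (C.transitive (at-z y) (C.symmetric (at-z z)))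

      at-xy : ⟦_⟧ 𝔸 t [ x , params y ] ≈ op f (λ i → d (x i) (z i) (y i))
      at-xy = C.transitive (t-eval x y) (d-right C _ _)

      at-xz : ⟦_⟧ 𝔸 t [ x , params z ] ≈ d (op f x) (op f z) (op f y)
      at-xz = C.transitive (t-eval x z)
        (d-cong C (C.compatible f (λ i → d-right C (x i) (z i))) C.reflexive C.reflexive)

    op-affine : ∀ k f (x z y : Fin (arity f) → A) →
      (∀ i → derived 𝔸 k (x i) (z i)) → (∀ i → derived 𝔸 k (y i) (z i)) →
      derived 𝔸 (suc k) (op f (λ i → d (x i) (z i) (y i))) (d (op f x) (op f z) (op f y))
    op-affine k f x z y p q δ c tc = op-affine-δ (derived-congruence k) c tc f x z y p q

    gate-affine : ∀ k {n s} (g : AGate 𝔸 n s) ρ (x z y : Fin s → A) →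
      (∀ i → derived 𝔸 k (x i) (z i)) → (∀ i → derived 𝔸 k (y i) (z i)) →
      derived 𝔸 (suc k) (aGateVal 𝔸 g ρ (λ i → d (x i) (z i) (y i)))
                        (d (aGateVal 𝔸 g ρ x) (aGateVal 𝔸 g ρ z) (aGateVal 𝔸 g ρ y))
    gate-affine k (avar i)   ρ x z y p q =
      -- Such a gate has the same value c at all arguments, and c = d(c,c,c).
      symmetric (derived-congruence (suc k)) (d-left (derived-congruence (suc k)) _ _)
    gate-affine k (aconst a) ρ x z y p q =
      symmetric (derived-congruence (suc k)) (d-left (derived-congruence (suc k)) _ _)
    gate-affine k (aop f js) ρ x z y p q = op-affine k f _ _ _ (p ∘ js) (q ∘ js)

  -- The circuit as a self-map on vectors of node values

  weaken : ∀ {n k} → AGate 𝔸 n k → AGate 𝔸 n (suc k)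
  weaken (avar i)   = avar i
  weaken (aconst a) = aconst a
  weaken (aop f js) = aop f (suc ∘ js)

  -- Each gate is re-indexed to read the vector of all node values, so that all gates can be applied
  -- at once; `aValues` is a fixed point of the resulting map.
  gateAt : ∀ {n k} → ACirc 𝔸 n k → Fin k → AGate 𝔸 n k
  gateAt (C ▷ g) zero    = weaken g
  gateAt (C ▷ g) (suc i) = weaken (gateAt C i)

  weaken-val : ∀ {n k} (g : AGate 𝔸 n k) ρ x → aGateVal 𝔸 (weaken g) ρ x ≡ aGateVal 𝔸 g ρ (x ∘ suc)
  weaken-val (avar i)   ρ x = refl
  weaken-val (aconst a) ρ x = refl
  weaken-val (aop f js) ρ x = refl

  values-fixed : ∀ {n k} (C : ACirc 𝔸 n k) ρ i →
    aGateVal 𝔸 (gateAt C i) ρ (aValues 𝔸 C ρ) ≡ aValues 𝔸 C ρ i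
  values-fixed (C ▷ g) ρ zero    = weaken-val g ρ _
  values-fixed (C ▷ g) ρ (suc i) = trans (weaken-val (gateAt C i) ρ _) (values-fixed C ρ i)

  -- The oldest nodes become correct first, one more in each round. An arbitrary sequence `x` is
  -- allowed because deleting the newest node from it leaves a sequence of the same kind for the
  -- smaller circuit.
  relaxation-converges : ∀ {R} → Congruence R → ∀ {n k} (C : ACirc 𝔸 n k) ρ (x : ℕ → Fin k → A) →
    (∀ m i → R (x (suc m) i) (aGateVal 𝔸 (gateAt C i) ρ (x m))) →
    ∀ m → k ≤ m → ∀ i → R (x m i) (aValues 𝔸 C ρ i)
  relaxation-converges {R} cong-R (C ▷ g) ρ x step (suc m) (s≤s k≤m) = go
    where
    module R = Congruence cong-R
    ih : ∀ m → _ ≤ m → ∀ i → R (x m (suc i)) (aValues 𝔸 C ρ i)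
    ih = relaxation-converges cong-R C ρ (λ m → x m ∘ suc)
      (λ m i → R.transitive (step m (suc i)) (R.≡⇒≈ (weaken-val (gateAt C i) ρ _)))
    go : ∀ i → R (x (suc m) i) (aValues 𝔸 (C ▷ g) ρ i)
    go zero    = R.transitive (step m zero)
      (R.transitive (R.≡⇒≈ (weaken-val g ρ _)) (R.gate-cong g ρ (ih m k≤m)))
    go (suc i) = ih (suc m) (m≤n⇒m≤1+n k≤m) i

  -- Tables of iterates and their squaring

  module Evaluation (malcev : IsMalcev 𝔸) {n s} (C : ACirc 𝔸 n s) (ρ : Fin n → A) where
    open Malcev malcev

    v : Fin s → A
    v = aValues 𝔸 C ρ

    T : (Fin s → A) → Fin s → A
    T x i = aGateVal 𝔸 (gateAt C i) ρ x

    Table : Set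
    Table = Fin s → Point s A → A

    linearise : (Fin s → A) → Table
    linearise z i p = T (perturb z p) i

    -- If `w` tabulates T^m near z, then `w k p` is coordinate k of y = T^m(z[p]). The leaves are
    -- coordinate i of T^m at the points z[k := y_k], and the tree combines them into coordinate i
    -- of T^m(y).
    square : ℕ → Table → Table
    square h w i p = foldTree d h 0 (λ k → w i (just (k , w k p))) (w i nothing)

    -- Only the column at `nothing` passes from one stage to the next: it holds the current
    -- approximation z, and after `h` squarings the better one.
    refine : ℕ → Table → Table
    refine h w = iterate (square h) h (linearise (λ i → w i nothing))

    module Step (k h : ℕ) (s≤2^h : s ≤ 2 ^ h)
        (z : Fin s → A) (z∼v : ∀ i → derived 𝔸 k (z i) (v i)) where
      α δ : A → A → Set
      α = derived 𝔸 k
      δ = derived 𝔸 (suc k)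
      module α = Congruence (derived-congruence k)
      module δ = Congruence (derived-congruence (suc k))
      cδ = derived-congruence (suc k)
      cα = derived-congruence k
      δ⊆α : ∀ {x y} → δ x y → α x y
      δ⊆α = derived-decreasing k

      -- A table has entries for all perturbations, but the term condition controls only those
      -- inside the `α`-class of z; nothing is claimed about the others.
      Near : Point s A → Set
      Near nothing        = ⊤
      Near (just (j , x)) = α x (z j)

      T-cong : ∀ {R} → Congruence R → ∀ m {x y} → (∀ i → R (x i) (y i)) →
        ∀ i → R (iterate T m x i) (iterate T m y i)
      T-cong c zero    p = p
      T-cong c (suc m) p i = Congruence.gate-cong c (gateAt C i) ρ (T-cong c m p)

      -- `T` fixes `v` and preserves `α`, so an iteration started in the `α`-class of `z`, which is
      -- that of `v`, never leaves it. This makes the term condition applicable in every round.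
      near-v : ∀ m {x} → (∀ i → α (x i) (z i)) → ∀ i → α (iterate T m x i) (v i)
      near-v zero    p i = α.transitive (p i) (z∼v i)
      near-v (suc m) p i = α.transitive
        (α.gate-cong (gateAt C i) ρ (near-v m p)) (α.≡⇒≈ (values-fixed C ρ i))

      near-z : ∀ m {x} → (∀ i → α (x i) (z i)) → ∀ i → α (iterate T m x i) (z i)
      near-z m p i = α.transitive (near-v m p i) (α.symmetric (z∼v i))

      -- Each gate commutes with `d` modulo `δ` on an `α`-class, and `near-v` keeps the three
      -- iterations in one class, so the property survives composition.
      T-affine : ∀ m {x y} → (∀ i → α (x i) (z i)) → (∀ i → α (y i) (z i)) → ∀ i →
        δ (iterate T m (λ j → d (x j) (z j) (y j)) i)
          (d (iterate T m x i) (iterate T m z i) (iterate T m y i))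
      T-affine zero    p q i = δ.reflexive
      T-affine (suc m) {x} {y} p q i = δ.transitive
        (δ.gate-cong (gateAt C i) ρ (T-affine m p q))
        (gate-affine k (gateAt C i) ρ _ _ _
          (λ j → α.transitive (near-v m p j) (α.symmetric (near-v m (λ _ → α.reflexive) j)))
          (λ j → α.transitive (near-v m q j) (α.symmetric (near-v m (λ _ → α.reflexive) j))))

      perturb-near : ∀ p → Near p → ∀ i → α (perturb z p i) (z i)
      perturb-near nothing        _  i = α.reflexive
      perturb-near (just (j , x)) x∼z i with i Fin.≟ j
      ... | yes refl = x∼z
      ... | no _     = α.reflexive

      perturb-cong : ∀ {R} → Congruence R → ∀ j {x y} → R x y →
        ∀ i → R (perturb z (just (j , x)) i) (perturb z (just (j , y)) i)
      perturb-cong c j r i with does (i Fin.≟ j)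
      ... | true  = r
      ... | false = reflexive c

      -- The tree of `square` carried out on argument vectors, with `d` taken coordinatewise. Modulo
      -- `δ` it rebuilds `y` on its block of coordinates and leaves `z` elsewhere.
      assemble : ℕ → ℕ → (Fin s → A) → Fin s → A
      assemble h o y = foldTree (λ a b c i → d (a i) (b i) (c i)) h o (λ k → perturb z (just (k , y k))) z

      assemble-outside : ∀ h o y i → toℕ i < o ⊎ o + 2 ^ h ≤ toℕ i → δ (assemble h o y i) (z i)
      assemble-outside zero o y i out with o <? s
      ... | no _ = δ.reflexive
      ... | yes o<s with i Fin.≟ fromℕ< o<s
      ...   | no _ = δ.reflexive
      ...   | yes refl rewrite Fin.toℕ-fromℕ< o<s with out
      ...     | inj₁ o<o   = ⊥-elim (<-irrefl refl o<o)
      ...     | inj₂ o+1≤o = ⊥-elim (<-irrefl refl (subst (_≤ o) (+-comm o 1) o+1≤o))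
      assemble-outside (suc h) o y i out = δ.transitive
        (d-cong cδ (assemble-outside h o y i (left out)) δ.reflexive
          (assemble-outside h (o + 2 ^ h) y i (right out)))
        (d-left cδ (z i) (z i))
        where
        left : toℕ i < o ⊎ o + 2 ^ suc h ≤ toℕ i → toℕ i < o ⊎ o + 2 ^ h ≤ toℕ i
        left (inj₁ p) = inj₁ p
        left (inj₂ p) = inj₂ (≤-trans (+-monoʳ-≤ o (m≤m+n (2 ^ h) _)) p)
        right : toℕ i < o ⊎ o + 2 ^ suc h ≤ toℕ i → toℕ i < o + 2 ^ h ⊎ o + 2 ^ h + 2 ^ h ≤ toℕ i
        right (inj₁ p) = inj₁ (≤-trans p (m≤m+n o _))
        right (inj₂ p) = inj₂ (subst (_≤ toℕ i)
          (trans (cong (λ e → o + (2 ^ h + e)) (+-identityʳ (2 ^ h))) (sym (+-assoc o _ _))) p)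

      -- Coordinate `i` lies in the block of exactly one subtree; the other subtree and the base
      -- both have z_i there, and d(y,z,z) = y = d(z,z,y).
      assemble-inside : ∀ h o y i → o ≤ toℕ i → toℕ i < o + 2 ^ h → δ (assemble h o y i) (y i)
      assemble-inside zero o y i o≤i i<o+1 with o <? s
      ... | no o≮s = ⊥-elim (o≮s (≤-<-trans o≤i (Fin.toℕ<n i)))
      ... | yes o<s with i Fin.≟ fromℕ< o<s
      ...   | yes refl = δ.reflexive
      ...   | no i≢o   = ⊥-elim (i≢o (Fin.toℕ-injective (trans
              (≤-antisym (m<1+n⇒m≤n (subst (toℕ i <_) (+-comm o 1) i<o+1)) o≤i)
              (sym (Fin.toℕ-fromℕ< o<s)))))
      assemble-inside (suc h) o y i o≤i i<o+ with toℕ i <? o + 2 ^ h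
      ... | yes i<mid = δ.transitive
        (d-cong cδ (assemble-inside h o y i o≤i i<mid) δ.reflexive
          (assemble-outside h _ y i (inj₁ i<mid)))
        (d-right cδ (y i) (z i))
      ... | no i≮mid = δ.transitive
        (d-cong cδ (assemble-outside h o y i (inj₂ (≮⇒≥ i≮mid))) δ.reflexive
          (assemble-inside h _ y i (≮⇒≥ i≮mid) (subst (toℕ i <_)
            (trans (cong (λ e → o + (2 ^ h + e)) (+-identityʳ (2 ^ h))) (sym (+-assoc o _ _))) i<o+)))
        (d-left cδ (y i) (z i))

      Approximates : ℕ → Table → Set
      Approximates m w = ∀ i p → Near p → δ (w i p) (iterate T m (perturb z p) i)

      -- T^{2m}(z[p]) = T^m(y) with y = T^m(z[p]). Modulo `δ`, `y` equals the assembled vector, and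
      -- `T-affine` moves T^m through its tree down to the leaves.
      square-approximates : ∀ m w → Approximates m w → Approximates (m + m) (square h w)
      square-approximates m w w≈ i p near = δ.transitive
        (proj₂ (foldTree-rel R step leaves (((λ _ → α.reflexive) , w≈ i nothing tt)) h 0))
        (δ.transitive
          (T-cong cδ m (λ j → assemble-inside h 0 y j z≤n (<-≤-trans (Fin.toℕ<n j) s≤2^h)) i)
          (δ.≡⇒≈ (cong (λ x → x i) (sym (iterate-+ T m m (perturb z p))))))
        where
        y : Fin s → A
        y = iterate T m (perturb z p)
        y∼z : ∀ j → α (y j) (z j)
        y∼z = near-z m (perturb-near p near)

        -- Besides the value, `R` records that the argument vector stays in the `α`-class of `z`, as
        -- `T-affine` demands at the next node.
        R : A → (Fin s → A) → Set
        R a x = (∀ j → α (x j) (z j)) × δ a (iterate T m x i)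

        step : ∀ {a x b y} → R a x → R b y →
          R (d a (w i nothing) b) (λ j → d (x j) (z j) (y j))
        step (x∼z , a≈) (y∼z , b≈) =
          (λ j → α.transitive (d-cong cα (x∼z j) α.reflexive (y∼z j)) (d-left cα (z j) (z j))) ,
          δ.transitive (d-cong cδ a≈ (w≈ i nothing tt) b≈) (δ.symmetric (T-affine m x∼z y∼z i))

        leaves : ∀ j → R (w i (just (j , w j p))) (perturb z (just (j , y j)))
        leaves j = perturb-near (just (j , y j)) (y∼z j) , δ.transitive
          -- The lookup index `w j p` equals y_j only modulo `δ`. As `δ` lies below `α` the point is
          -- still near, and `T-cong` absorbs the difference.
          (w≈ i (just (j , w j p)) (α.transitive (δ⊆α (w≈ j p near)) (y∼z j)))
          (T-cong cδ m (perturb-cong cδ j (w≈ j p near)) i)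

      iterate-square : ∀ w → Approximates 1 w → ∀ m → Approximates (2 ^ m) (iterate (square h) m w)
      iterate-square w w≈ zero    = w≈
      iterate-square w w≈ (suc m) = subst (λ e → Approximates e (iterate (square h) (suc m) w))
        (cong (2 ^ m +_) (sym (+-identityʳ (2 ^ m))))
        (square-approximates (2 ^ m) _ (iterate-square w w≈ m))

      refined : ∀ i → δ (iterate (square h) h (linearise z) i nothing) (v i)
      refined i = δ.transitive
        (iterate-square (linearise z) (λ i p near → δ.reflexive) h i nothing tt)
        (relaxation-converges cδ C ρ (λ m → iterate T m z) (λ m i → δ.reflexive) (2 ^ h) s≤2^h i)

    module _ (h : ℕ) (s≤2^h : s ≤ 2 ^ h) where

      iterate-refine : ∀ w k i → derived 𝔸 k (iterate (refine h) k w i nothing) (v i)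
      -- The series starts with the full relation, so any initial table will do.
      iterate-refine w zero    i = tt
      iterate-refine w (suc k) i = Step.refined k h s≤2^h _ (iterate-refine w k) i

-- Boolean formulas and layered circuits

data Connective : Set where
  conj disj : Connective

connect : Connective → Bool → Bool → Bool
connect conj = _∧_
connect disj = _∨_

data Formula (n : ℕ) (V : Set) : Set where
  input  : Fin n → Formula n V
  wire   : V → Formula n V
  const  : Bool → Formula n V
  neg    : Formula n V → Formula n V
  binary : Connective → Formula n V → Formula n V → Formula n V

pattern _and_ φ ψ = binary conj φ ψ
pattern _or_ φ ψ  = binary disj φ ψ

eval : ∀ {n V} → Formula n V → (Fin n → Bool) → (V → Bool) → Bool
eval (input i)      ρ x = ρ i
eval (wire v)       ρ x = x v
eval (const b)      ρ x = b
eval (neg φ)        ρ x = not (eval φ ρ x)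
eval (binary c φ ψ) ρ x = connect c (eval φ ρ x) (eval ψ ρ x)

depth : ∀ {n V} → Formula n V → ℕ
depth (input i)      = 0
depth (wire v)       = 0
depth (const b)      = 0
depth (neg φ)        = suc (depth φ)
depth (binary c φ ψ) = suc (depth φ ⊔ depth ψ)

gateCount : ∀ {n V} → Formula n V → ℕ
gateCount (input i)      = 1
gateCount (wire v)       = 0
gateCount (const b)      = 1
gateCount (neg φ)        = suc (gateCount φ)
gateCount (binary c φ ψ) = suc (gateCount φ + gateCount ψ)

-- A binary tree has size at most exponential in its depth. Formulas of logarithmic depth are
-- therefore polynomial, and only depth needs tracking from here on.
gateCount-depth : ∀ {n V} (φ : Formula n V) → suc (gateCount φ) ≤ 2 ^ suc (depth φ)
gateCount-depth (input i) = ≤-refl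
gateCount-depth (wire v)  = s≤s z≤n
gateCount-depth (const b) = ≤-refl
gateCount-depth (neg φ)   = begin
  2 + gateCount φ                           ≤⟨ +-mono-≤ (m^n>0 2 (suc (depth φ))) (gateCount-depth φ) ⟩
  2 ^ suc (depth φ) + 2 ^ suc (depth φ)     ≡⟨ cong (2 ^ suc (depth φ) +_) (+-identityʳ _) ⟨
  2 ^ suc (suc (depth φ))                   ∎
  where open ≤-Reasoning
gateCount-depth (binary c φ ψ) = begin
  suc (suc (gateCount φ + gateCount ψ))     ≡⟨ cong suc (+-suc (gateCount φ) (gateCount ψ)) ⟨
  suc (gateCount φ) + suc (gateCount ψ)     ≤⟨ +-mono-≤ (bound φ (m≤m⊔n _ _)) (bound ψ (m≤n⊔m (depth φ) _)) ⟩
  2 ^ suc d + 2 ^ suc d                     ≡⟨ cong (2 ^ suc d +_) (+-identityʳ _) ⟨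
  2 ^ suc (suc d)                           ∎
  where
  open ≤-Reasoning
  d = depth φ ⊔ depth ψ
  bound : ∀ χ → depth χ ≤ d → suc (gateCount χ) ≤ 2 ^ suc d
  bound χ p = ≤-trans (gateCount-depth χ) (^-monoʳ-≤ 2 (s≤s p))

-- Compilation of formulas into straight-line programs

data _⊑_ {n k} (C : BCirc n k) : ∀ {k′} → BCirc n k′ → Set where
  done : C ⊑ C
  more : ∀ {k′} {C′ : BCirc n k′} {g} → C ⊑ C′ → C ⊑ (C′ ▷ g)

⊑-trans : ∀ {n k k′ k″} {C : BCirc n k} {C′ : BCirc n k′} {C″ : BCirc n k″} →
  C ⊑ C′ → C′ ⊑ C″ → C ⊑ C″
⊑-trans p done     = p
⊑-trans p (more q) = more (⊑-trans p q)

lift : ∀ {n k k′} {C : BCirc n k} {C′ : BCirc n k′} → C ⊑ C′ → Fin k → Fin k′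
lift done     i = i
lift (more p) i = suc (lift p i)

lift-value : ∀ {n k k′} {C : BCirc n k} {C′ : BCirc n k′} (p : C ⊑ C′) ρ i →
  bValues C′ ρ (lift p i) ≡ bValues C ρ i
lift-value done     ρ i = refl
lift-value (more p) ρ i = lift-value p ρ i

lift-depth : ∀ {n k k′} {C : BCirc n k} {C′ : BCirc n k′} (p : C ⊑ C′) i →
  bDepths C′ (lift p i) ≡ bDepths C i
lift-depth done     i = refl
lift-depth (more p) i = lift-depth p i

record Wires {n k} (C : BCirc n k) (V : Set) (f : (Fin n → Bool) → V → Bool) (D : ℕ) : Set where
  field
    at       : V → Fin k
    computes : ∀ ρ v → bValues C ρ (at v) ≡ f ρ v
    shallow  : ∀ v → bDepths C (at v) ≤ D
open Wires

liftWires : ∀ {n k k′ V f D} {C : BCirc n k} {C′ : BCirc n k′} →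
  C ⊑ C′ → Wires C V f D → Wires C′ V f D
liftWires p w .at         = lift p ∘ at w
liftWires p w .computes ρ v = trans (lift-value p ρ (at w v)) (computes w ρ v)
liftWires p w .shallow v  = subst (_≤ _) (sym (lift-depth p (at w v))) (shallow w v)

record Extension {n k} (C : BCirc n k) (V : Set) (f : (Fin n → Bool) → V → Bool) (D B : ℕ) : Set where
  field
    {gates}  : ℕ
    circuit  : BCirc n gates
    extends  : C ⊑ circuit
    wires    : Wires circuit V f D
    small    : gates ≤ B + k
open Extension

connective : ∀ {n k} → Connective → Fin k → Fin k → BGate n k
connective conj = band
connective disj = bor

connective-value : ∀ {n k} {i j : Fin k} {x} c (ρ : Fin n → Bool) →
  bGateVal (connective c i j) ρ x ≡ connect c (x i) (x j)
connective-value conj ρ = refl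
connective-value disj ρ = refl

connective-depth : ∀ {n k} {i j : Fin k} {x} c →
  bGateDepth {n} (connective c i j) x ≡ suc (x i ⊔ x j)
connective-depth conj = refl
connective-depth disj = refl

compile : ∀ {n k V f D} {C : BCirc n k} → Wires C V f D → (φ : Formula n V) →
  Extension C ⊤ (λ ρ _ → eval φ ρ (f ρ)) (D + depth φ) (gateCount φ)
compile {C = C} w (input i) = record
  { circuit = C ▷ bvar i ; extends = more done ; small = ≤-refl
  ; wires = record { at = λ _ → zero ; computes = λ _ _ → refl ; shallow = λ _ → z≤n } }
compile {C = C} w (wire v) = record
  { circuit = C ; extends = done ; small = ≤-refl
  ; wires = record { at = λ _ → at w v ; computes = λ ρ _ → computes w ρ v
                   ; shallow = λ _ → ≤-trans (shallow w v) (m≤m+n _ 0) } }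
compile {C = C} w (const b) = record
  { circuit = C ▷ bconst b ; extends = more done ; small = ≤-refl
  ; wires = record { at = λ _ → zero ; computes = λ _ _ → refl ; shallow = λ _ → z≤n } }
compile {D = D} w (neg φ) = let e = compile w φ in record
  { circuit = circuit e ▷ bnot (at (wires e) tt) ; extends = more (extends e) ; small = s≤s (small e)
  ; wires = record { at = λ _ → zero ; computes = λ ρ _ → cong not (computes (wires e) ρ tt)
                   ; shallow = λ _ → ≤-trans (s≤s (shallow (wires e) tt))
                       (≤-reflexive (sym (+-suc D (depth φ)))) } }
compile {n} {k} {D = D} w (binary c φ ψ) =
  let e₁ = compile w φ
      e₂ = compile (liftWires (extends e₁) w) ψ
      w₁ = liftWires (extends e₂) (wires e₁)
  in record
  { circuit = circuit e₂ ▷ connective c (at w₁ tt) (at (wires e₂) tt)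
  ; extends = more (⊑-trans (extends e₁) (extends e₂))
  ; small = s≤s (≤-trans (small e₂) (≤-trans (+-monoʳ-≤ (gateCount ψ) (small e₁)) (≤-reflexive
      (trans (sym (+-assoc (gateCount ψ) (gateCount φ) k))
             (cong (_+ k) (+-comm (gateCount ψ) (gateCount φ)))))))
  ; wires = record
      { at = λ _ → zero
      ; computes = λ ρ _ → trans (connective-value {x = bValues (circuit e₂) ρ} c ρ)
          (cong₂ (connect c) (computes w₁ ρ tt) (computes (wires e₂) ρ tt))
      ; shallow = λ _ → ≤-trans (≤-reflexive (connective-depth {n} c)) (≤-trans
          (s≤s (⊔-mono-≤ (shallow w₁ tt) (shallow (wires e₂) tt)))
          (≤-reflexive (trans (cong suc (sym (+-distribˡ-⊔ D (depth φ) (depth ψ))))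
                              (sym (+-suc D (depth φ ⊔ depth ψ)))))) } }

-- The formulas are appended one after another, but all read the same wires, so sizes add up while
-- the depth grows by `E` only once.
compileAll : ∀ {n k V f D} {C : BCirc n k} → Wires C V f D → ∀ E M (φ : Fin M → Formula n V) →
  (∀ i → depth (φ i) ≤ E) →
  Extension C (Fin M) (λ ρ i → eval (φ i) ρ (f ρ)) (D + E) (M * 2 ^ suc E)
compileAll {C = C} w E zero φ φ≤E = record
  { circuit = C ; extends = done ; small = ≤-refl
  ; wires = record { at = λ () ; computes = λ _ () ; shallow = λ () } }
compileAll {n} {k} {f = f} {D} w E (suc M) φ φ≤E =
  let e₁ = compile w (φ zero)
      e₂ = compileAll (liftWires (extends e₁) w) E M (φ ∘ suc) (φ≤E ∘ suc)
      w₁ = liftWires (extends e₂) (wires e₁)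
      c  = 2 ^ suc E
  in record
  { circuit = circuit e₂
  ; extends = ⊑-trans (extends e₁) (extends e₂)
  ; small = ≤-trans (small e₂) (≤-trans (+-monoʳ-≤ (M * c) (≤-trans (small e₁) (+-monoˡ-≤ k
      (≤-trans (n≤1+n _) (≤-trans (gateCount-depth (φ zero)) (^-monoʳ-≤ 2 (s≤s (φ≤E zero))))))))
      (≤-reflexive (trans (sym (+-assoc (M * c) c k)) (cong (_+ k) (+-comm (M * c) c)))))
  ; wires = record { at = λ { zero → at w₁ tt ; (suc i) → at (wires e₂) i }
                   ; computes = λ { ρ zero → computes w₁ ρ tt ; ρ (suc i) → computes (wires e₂) ρ i }
                   ; shallow = λ { zero → ≤-trans (shallow w₁ tt) (+-monoʳ-≤ D (φ≤E zero))
                                 ; (suc i) → shallow (wires e₂) i } } }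

Realised : (n : ℕ) (V : Set) (f : (Fin n → Bool) → V → Bool) (D B : ℕ) → Set
Realised n V f D B = Extension {n} [] V f D B

-- The formulas need to be correct only on the wire values `f ρ` that occur, and not on arbitrary
-- bit patterns; hence one-hot validity comes for free in later layers.
addLayer : ∀ {n V V′ f D B M} {f′ : (Fin n → Bool) → V′ → Bool} →
  Fin M ↔ V′ → Realised n V f D B →
  ∀ E (φ : V′ → Formula n V) → (∀ v → depth (φ v) ≤ E) →
  (∀ ρ v → eval (φ v) ρ (f ρ) ≡ f′ ρ v) →
  Realised n V′ f′ (E + D) (M * 2 ^ suc E + B)
addLayer {n} {f = f} {D} {B} {M} {f′} M↔V′ r E φ φ≤E φ≡f′ = record
  { circuit = circuit e
  ; extends = ⊑-trans (extends r) (extends e)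
  ; small = ≤-trans (small e) (subst (M * 2 ^ suc E + gates r ≤_) (sym (+-assoc (M * 2 ^ suc E) B 0))
      (+-monoʳ-≤ (M * 2 ^ suc E) (small r)))
  ; wires = record
    { at = at (wires e) ∘ from
    ; computes = λ ρ v → trans (computes (wires e) ρ (from v))
        (trans (φ≡f′ ρ (to (from v))) (cong (f′ ρ) (strictlyInverseˡ v)))
    ; shallow = λ v → ≤-trans (shallow (wires e) (from v)) (≤-reflexive (+-comm D E)) } }
  where
  open Inverse M↔V′
  e = compileAll (wires r) E M (φ ∘ to) (φ≤E ∘ to)

-- An unbalanced chain is good enough: `m` will be the size of the algebra, a constant.
anyOf : ∀ {n V m} → (Fin m → Formula n V) → Formula n V
anyOf {m = zero}  φ = const false
anyOf {m = suc m} φ = φ zero or anyOf (φ ∘ suc)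

anyOf-depth : ∀ {n V m} (φ : Fin m → Formula n V) {E} →
  (∀ i → depth (φ i) ≤ E) → depth (anyOf φ) ≤ m + E
anyOf-depth {m = zero}  φ φ≤E = z≤n
anyOf-depth {m = suc m} φ φ≤E = s≤s (⊔-lub
  (≤-trans (φ≤E zero) (m≤n+m _ m)) (anyOf-depth (φ ∘ suc) (φ≤E ∘ suc)))

-- Elements of Fin q are one-hot encoded.
module _ {n : ℕ} {V : Set} where

  Word : ℕ → Set
  Word q = Fin q → Formula n V

  _⟨_,_⟩↦_ : ∀ {q} → Word q → (Fin n → Bool) → (V → Bool) → Fin q → Set
  W ⟨ ρ , x ⟩↦ a = ∀ b → eval (W b) ρ x ≡ does (a Fin.≟ b)

  anyOf-false : ∀ {m} (φ : Fin m → Formula n V) ρ x →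
    (∀ i → eval (φ i) ρ x ≡ false) → eval (anyOf φ) ρ x ≡ false
  anyOf-false {zero}  φ ρ x p = refl
  anyOf-false {suc m} φ ρ x p rewrite p zero = anyOf-false (φ ∘ suc) ρ x (p ∘ suc)

  select : ∀ {q} → Word q → (Fin q → Formula n V) → Formula n V
  select W φ = anyOf (λ a → W a and φ a)

  select-eval : ∀ {q} (W : Word q) φ {ρ x a} →
    W ⟨ ρ , x ⟩↦ a → eval (select W φ) ρ x ≡ eval (φ a) ρ x
  select-eval {suc q} W φ {ρ} {x} {zero} W↦a rewrite W↦a zero
    | anyOf-false (λ a → W (suc a) and φ (suc a)) ρ x
        (λ i → cong (_∧ eval (φ (suc i)) ρ x) (W↦a (suc i)))
    = ∨-identityʳ _
  select-eval {suc q} W φ {ρ} {x} {suc a} W↦a rewrite W↦a zero =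
    select-eval (W ∘ suc) (φ ∘ suc) {a = a} (W↦a ∘ suc)

  select-depth : ∀ {q} (W : Word q) φ {E} → (∀ a → depth (W a) ≤ E) → (∀ a → depth (φ a) ≤ E) →
    depth (select W φ) ≤ q + suc E
  select-depth W φ W≤E φ≤E = anyOf-depth _ (λ a → s≤s (⊔-lub (W≤E a) (φ≤E a)))

  -- The decision tree of `g`, branching on one argument at a time; its depth depends only on the
  -- algebra.
  applyOp : ∀ {q} r → (Vec (Fin q) r → Fin q) → (Fin r → Word q) → Word q
  applyOp zero    g Ws b = const (does (g [] Fin.≟ b))
  applyOp (suc r) g Ws b = select (Ws zero) (λ a → applyOp r (g ∘ (a ∷_)) (Ws ∘ suc) b)

  applyOp-eval : ∀ {q} r g (Ws : Fin r → Word q) {ρ x a} → (∀ i → Ws i ⟨ ρ , x ⟩↦ a i) →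
    applyOp r g Ws ⟨ ρ , x ⟩↦ g (tabulate a)
  applyOp-eval zero    g Ws Ws↦a b = refl
  applyOp-eval (suc r) g Ws {a = a} Ws↦a b = trans
    (select-eval (Ws zero) (λ a → applyOp r (g ∘ (a ∷_)) (Ws ∘ suc) b) (Ws↦a zero))
    (applyOp-eval r (g ∘ (a zero ∷_)) (Ws ∘ suc) (Ws↦a ∘ suc) b)

  applyOp-depth : ∀ {q} r g (Ws : Fin r → Word q) {E} → (∀ i a → depth (Ws i a) ≤ E) →
    ∀ b → depth (applyOp r g Ws b) ≤ r * suc q + E
  applyOp-depth zero g Ws Ws≤E b = z≤n
  applyOp-depth {q} (suc r) g Ws {E} Ws≤E b = subst (depth (applyOp (suc r) g Ws b) ≤_)
    (trans (+-suc q _) (sym (+-assoc (suc q) (r * suc q) E)))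
    (select-depth (Ws zero) _ (λ a → ≤-trans (Ws≤E zero a) (m≤n+m E _))
      (λ a → applyOp-depth r (g ∘ (a ∷_)) (Ws ∘ suc) (Ws≤E ∘ suc) b))

maximum : ∀ {m} (f : Fin m → ℕ) → ∃ λ B → ∀ i → f i ≤ B
maximum {zero}  f = 0 , λ ()
maximum {suc m} f = let B , f≤B = maximum (f ∘ suc) in
  f zero ⊔ B , λ { zero → m≤m⊔n _ _ ; (suc i) → ≤-trans (f≤B i) (m≤n⊔m _ _) }

-- The simulation

maybe-finite : ∀ {m} {X : Set} → Fin m ↔ X → Fin (suc m) ↔ Maybe X
maybe-finite {m} {X} i = mk↔ₛ′ to′ from′ invˡ invʳ
  where
  open Inverse i
  to′ : Fin (suc m) → Maybe X
  to′ zero    = nothing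
  to′ (suc k) = just (to k)
  from′ : Maybe X → Fin (suc m)
  from′ nothing  = zero
  from′ (just x) = suc (from x)
  invˡ : ∀ x → to′ (from′ x) ≡ x
  invˡ nothing  = refl
  invˡ (just x) = cong just (strictlyInverseˡ x)
  invʳ : ∀ k → from′ (to′ k) ≡ k
  invʳ zero    = refl
  invʳ (suc k) = cong suc (strictlyInverseʳ k)

×-finite : ∀ {m n} {X Y : Set} → Fin m ↔ X → Fin n ↔ Y → Fin (m * n) ↔ (X × Y)
×-finite {m} {n} i j = (i ×-↔ j) ↔-∘ Fin.*↔× {m} {n}

module Simulation (𝔸 : FinAlgebra) (malcev : IsMalcev 𝔸) (solvable : IsSolvable 𝔸)
    (ι : Bool → Fin (FinAlgebra.size 𝔸)) (S : Subset (FinAlgebra.size 𝔸)) where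
  open FinAlgebra 𝔸
  open Congruences 𝔸
  open Malcev malcev

  private
    q = size
    R = proj₁ (maximum arity)
    K = proj₁ solvable

  module Compiled {n s : ℕ} (C : ACirc 𝔸 n (suc s)) (h : ℕ) (s<2^h : suc s ≤ 2 ^ h) where

    module Eval (ρ : Fin n → Bool) = Evaluation malcev C (ι ∘ ρ)

    Table : Set
    Table = Fin (suc s) → Point (suc s) A → A

    V : Set
    V = Fin (suc s) × Point (suc s) A × A

    wordSize : ℕ
    wordSize = suc s * (suc (suc s * q) * q)

    V-finite : Fin wordSize ↔ V
    V-finite = ×-finite (↔-id _) (×-finite (maybe-finite (×-finite (↔-id _) (↔-id _))) (↔-id _))

    bits : Table → V → Bool
    bits w (i , p , a) = does (w i p Fin.≟ a)

    entry : Fin (suc s) → Point (suc s) A → Word {n} {V} q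
    entry i p a = wire (i , p , a)

    constant : A → Word {n} {V} q
    constant x a = const (does (x Fin.≟ a))

    gateWord : AGate 𝔸 n (suc s) → (Fin (suc s) → Word {n} {V} q) → Word {n} {V} q
    gateWord (avar i)   Ws b =
      (input i and constant (ι true) b) or (neg (input i) and constant (ι false) b)
    gateWord (aconst a) Ws   = constant a
    gateWord (aop f js) Ws   = applyOp (arity f) (λ xs → op f (lookup xs)) (Ws ∘ js)

    gateWord-eval : ∀ g Ws ρ {x z} → (∀ k → Ws k ⟨ ρ , x ⟩↦ z k) →
      gateWord g Ws ⟨ ρ , x ⟩↦ aGateVal 𝔸 g (ι ∘ ρ) z
    gateWord-eval (avar i)   Ws ρ Ws↦z b with ρ i
    ... | true  = ∨-identityʳ _
    ... | false = refl
    gateWord-eval (aconst a) Ws ρ Ws↦z b = refl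
    gateWord-eval (aop f js) Ws ρ {z = z} Ws↦z b = trans
      (applyOp-eval (arity f) (λ xs → op f (lookup xs)) (Ws ∘ js) (Ws↦z ∘ js) b)
      -- The round trip of the arguments through a vector is the identity only pointwise, whence
      -- `op-cong`.
      (cong (λ a → does (a Fin.≟ b)) (op-cong solvable f (lookup∘tabulate (z ∘ js))))

    -- `R * suc q` pays for an operation of maximal arity, 3 for the formula of a variable gate.
    gateDepth : ℕ
    gateDepth = R * suc q + 3

    gateWord-depth : ∀ g Ws → (∀ k a → depth (Ws k a) ≤ 0) →
      ∀ b → depth (gateWord g Ws b) ≤ gateDepth
    gateWord-depth (avar i)   Ws Ws≤0 b = m≤n+m 3 (R * suc q)
    gateWord-depth (aconst a) Ws Ws≤0 b = z≤n
    gateWord-depth (aop f js) Ws Ws≤0 b = ≤-trans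
      (applyOp-depth (arity f) _ (Ws ∘ js) (λ i → Ws≤0 (js i)) b)
      (+-mono-≤ (*-monoˡ-≤ (suc q) (proj₂ (maximum arity) f)) z≤n)

    perturbWord : Point (suc s) A → Fin (suc s) → Word {n} {V} q
    perturbWord nothing        k = entry k nothing
    perturbWord (just (j , x)) k = if does (k Fin.≟ j) then constant x else entry k nothing

    perturbWord-eval : ∀ p k ρ w → perturbWord p k ⟨ ρ , bits w ⟩↦ perturb (λ i → w i nothing) p k
    perturbWord-eval nothing        k ρ w b = refl
    perturbWord-eval (just (j , x)) k ρ w b with does (k Fin.≟ j)
    ... | true  = refl
    ... | false = refl

    perturbWord-depth : ∀ p k a → depth (perturbWord p k a) ≤ 0
    perturbWord-depth nothing        k a = z≤n
    perturbWord-depth (just (j , x)) k a with does (k Fin.≟ j)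
    ... | true  = z≤n
    ... | false = z≤n

    lineariseF : V → Formula n V
    lineariseF (i , p , b) = gateWord (gateAt C i) (perturbWord p) b

    d-vec : Vec A 3 → A
    d-vec xs = ⟦_⟧ 𝔸 d-term (lookup xs)

    d-word : Word {n} {V} q → Word {n} {V} q → Word {n} {V} q → Word {n} {V} q
    d-word U W X = applyOp 3 d-vec (lookup (U ∷ W ∷ X ∷ []))

    d-word-eval : ∀ {ρ x U W X a b c} → U ⟨ ρ , x ⟩↦ a → W ⟨ ρ , x ⟩↦ b → X ⟨ ρ , x ⟩↦ c →
      d-word U W X ⟨ ρ , x ⟩↦ d a b c
    d-word-eval {U = U} {W} {X} {a} {b} {c} U↦a W↦b X↦c =
      applyOp-eval 3 d-vec (lookup (U ∷ W ∷ X ∷ [])) {a = lookup (a ∷ b ∷ c ∷ [])}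
        λ { zero → U↦a ; (suc zero) → W↦b ; (suc (suc zero)) → X↦c }

    treeStep : ℕ
    treeStep = 3 * suc q

    tree-depth : ∀ {m} (leaf : Fin m → Word {n} {V} q) base {E} →
      (∀ k a → depth (leaf k a) ≤ E) → (∀ a → depth (base a) ≤ E) →
      ∀ h o a → depth (foldTree d-word h o leaf base a) ≤ h * treeStep + E
    tree-depth {m} leaf base leaf≤E base≤E zero o a with o <? m
    ... | yes o<m = leaf≤E (fromℕ< o<m) a
    ... | no _    = base≤E a
    tree-depth leaf base {E} leaf≤E base≤E (suc h) o a = subst
      (depth (foldTree d-word (suc h) o leaf base a) ≤_)
      (sym (+-assoc treeStep (h * treeStep) E))
      (applyOp-depth 3 d-vec (lookup (_ ∷ _ ∷ _ ∷ [])) {h * treeStep + E}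
        (λ { zero → tree-depth leaf base leaf≤E base≤E h o
           ; (suc zero) → λ b → ≤-trans (base≤E b) (m≤n+m E _)
           ; (suc (suc zero)) → tree-depth leaf base leaf≤E base≤E h (o + 2 ^ h) }) a)

    -- A lookup at an index that is itself a table entry, done by cases over all its possible
    -- values.
    compose : Fin (suc s) → Point (suc s) A → Fin (suc s) → Word {n} {V} q
    compose i p k b = select (entry k p) (λ a → entry i (just (k , a)) b)

    squareF : V → Formula n V
    squareF (i , p , b) = foldTree d-word h 0 (compose i p) (entry i nothing) b

    squareF-eval : ∀ ρ w v → eval (squareF v) ρ (bits w) ≡ bits (Eval.square ρ h w) v
    squareF-eval ρ w (i , p , b) =
      foldTree-rel _⟨ ρ , bits w ⟩↦_ {leaf = compose i p} {leaf′ = λ k → w i (just (k , w k p))}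
        (λ U↦a W↦b → d-word-eval U↦a (λ _ → refl) W↦b)
        (λ k b → select-eval (entry k p) (λ a → entry i (just (k , a)) b) {a = w k p} (λ _ → refl))
        (λ _ → refl) h 0 b

    -- One bound for every kind of layer, with a sum in place of a maximum, so that total depth is a
    -- multiple of it.
    layerDepth : ℕ
    layerDepth = gateDepth + (h * treeStep + suc q)

    layerSize : ℕ
    layerSize = wordSize * 2 ^ suc layerDepth

    squareF-depth : ∀ v → depth (squareF v) ≤ layerDepth
    squareF-depth (i , p , b) = ≤-trans
      (tree-depth (compose i p) (entry i nothing)
        (λ k a → ≤-trans (select-depth (entry k p) _ {0} (λ _ → z≤n) (λ _ → z≤n))
          (≤-reflexive (+-comm q 1)))
        (λ a → z≤n) h 0 b)
      (m≤n+m _ gateDepth)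

    record Layers (ℓ : ℕ) (w : (Fin n → Bool) → Table) : Set where
      constructor layers
      field realised : Realised n V (bits ∘ w) (ℓ * layerDepth) (ℓ * layerSize)
    open Layers

    layer : ∀ {ℓ w w′} (φ : V → Formula n V) → (∀ v → depth (φ v) ≤ layerDepth) →
      (∀ ρ v → eval (φ v) ρ (bits (w ρ)) ≡ bits (w′ ρ) v) → Layers ℓ w → Layers (suc ℓ) w′
    layer φ φ≤ φ≡ r = layers (addLayer V-finite (realised r) layerDepth φ φ≤ φ≡)

    squareLayers : ∀ m {ℓ w} →
      Layers ℓ w → Layers (m + ℓ) (λ ρ → iterate (Eval.square ρ h) m (w ρ))
    squareLayers zero    r = r
    squareLayers (suc m) {w = w} r = layer squareF squareF-depth
      (λ ρ → squareF-eval ρ (iterate (Eval.square ρ h) m (w ρ))) (squareLayers m r)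

    refineLayers : ∀ {ℓ w} → Layers ℓ w → Layers (h + suc ℓ) (λ ρ → Eval.refine ρ h (w ρ))
    refineLayers {w = w} r = squareLayers h (layer lineariseF
      (λ (i , p , b) → ≤-trans (gateWord-depth (gateAt C i) _ (perturbWord-depth p) b) (m≤m+n _ _))
      (λ ρ (i , p , b) → gateWord-eval (gateAt C i) _ ρ (λ k → perturbWord-eval p k ρ (w ρ)) b)
      r)

    -- `ι true` is merely some element of the carrier.
    start : Table
    start i p = ι true

    startLayer : Layers 1 (λ _ → start)
    startLayer = layers (addLayer {V = ⊥} {f = λ _ ()} {D = 0} {B = 0} V-finite
      (record { circuit = [] ; extends = done ; small = z≤n
              ; wires = record { at = λ () ; computes = λ _ () ; shallow = λ () } })
      layerDepth (λ (_ , _ , a) → const (does (ι true Fin.≟ a))) (λ _ → z≤n) (λ _ _ → refl))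

    -- Each stage takes one linearising layer and `h` squarings; the last 1 is the starting layer.
    layerCount : ℕ → ℕ
    layerCount k = k * suc h + 1

    stages : ∀ k → Layers (layerCount k) (λ ρ → iterate (Eval.refine ρ h) k start)
    stages zero    = startLayer
    stages (suc k) = subst (λ ℓ → Layers ℓ (λ ρ → iterate (Eval.refine ρ h) (suc k) start))
      (trans (+-suc h _) (cong suc (sym (+-assoc h (k * suc h) 1))))
      (refineLayers (stages k))

    output : Realised n ⊤ (λ ρ _ → lookup S (aOut 𝔸 C (ι ∘ ρ)))
      (layerDepth + layerCount K * layerDepth) (1 * 2 ^ suc layerDepth + layerCount K * layerSize)
    output = addLayer Fin.1↔⊤ (realised (stages K)) layerDepth
      (λ _ → select (entry zero nothing) (λ a → const (lookup S a)))
      (λ _ → ≤-trans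
        (select-depth (entry zero nothing) (λ a → const (lookup S a)) {0} (λ _ → z≤n) (λ _ → z≤n))
        (≤-trans (≤-reflexive (+-comm q 1))
          (≤-trans (m≤n+m (suc q) (h * treeStep)) (m≤n+m _ gateDepth))))
      (λ ρ _ → trans
        (select-eval (entry zero nothing) (λ a → const (lookup S a))
          {a = iterate (Eval.refine ρ h) K start zero nothing} (λ _ → refl))
        -- `derived 𝔸 K` is contained in equality, so after `K` stages the output node has its exact
        -- value.
        (cong (lookup S) (proj₂ solvable _ _ (Eval.iterate-refine ρ h s<2^h start K zero))))

    result : BCirc n (suc (gates output))
    -- `bOut` reads the newest node; the disjunction of the output wire with itself puts its value
    -- there.
    result = circuit output ▷ bor (at (wires output) tt) (at (wires output) tt)

    result-correct : ∀ ρ → bOut result ρ ≡ lookup S (aOut 𝔸 C (ι ∘ ρ))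
    result-correct ρ = trans (∨-idem _) (computes (wires output) ρ tt)

    -- The slack gives a product of two factors, each linear in `h`, as `square-bound` expects.
    result-depth : bDepth result ≤ (2 + layerCount K) * suc layerDepth
    result-depth = begin
      suc (δ ⊔ δ)                                      ≡⟨ cong suc (⊔-idem δ) ⟩
      suc δ                                            ≤⟨ s≤s (shallow (wires output) tt) ⟩
      suc (layerDepth + layerCount K * layerDepth)     ≤⟨ m≤m+n _ _ ⟩
      suc (layerDepth + layerCount K * layerDepth) + (1 + layerCount K + layerDepth)
                                                       ≡⟨ eq (layerCount K) layerDepth ⟩
      (2 + layerCount K) * suc layerDepth              ∎
      where
      open ≤-Reasoning
      δ = bDepths (circuit output) (at (wires output) tt)
      eq : ∀ ℓ e → suc (e + ℓ * e) + (1 + ℓ + e) ≡ (2 + ℓ) * suc e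
      eq = solve-∀

    result-size : suc (gates output) ≤ (2 + layerCount K) * (suc wordSize * 2 ^ suc layerDepth)
    result-size = begin
      suc (gates output)                                            ≤⟨ s≤s (small output) ⟩
      suc (1 * P + layerCount K * (wordSize * P) + 0)               ≤⟨ +-monoˡ-≤ _ (m^n>0 2 (suc layerDepth)) ⟩
      P + (1 * P + layerCount K * (wordSize * P) + 0)               ≤⟨ m≤m+n _ _ ⟩
      P + (1 * P + layerCount K * (wordSize * P) + 0) + (layerCount K * P + 2 * (wordSize * P))
                                                                    ≡⟨ eq P (layerCount K) wordSize ⟩
      (2 + layerCount K) * (suc wordSize * P)                       ∎
      where
      open ≤-Reasoning
      P = 2 ^ suc layerDepth
      eq : ∀ p ℓ m → p + (1 * p + ℓ * (m * p) + 0) + (ℓ * p + 2 * (m * p)) ≡ (2 + ℓ) * (suc m * p)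
      eq = solve-∀

-- Size and depth estimates

private
  -- Stated for any accessibility proof, so that the induction follows the recursion defining the
  -- logarithm.
  lower : ∀ n (rs : Acc _<_ (suc n)) → 2 ^ ⌊log2⌋ (suc n) rs ≤ suc n
  lower zero    _        = ≤-refl
  lower (suc n) (acc rs) = begin
    2 ^ suc (⌊log2⌋ (suc ⌊ n /2⌋) _)   ≤⟨ *-monoʳ-≤ 2 (lower ⌊ n /2⌋ _) ⟩
    2 * suc ⌊ n /2⌋                    ≡⟨ eq ⌊ n /2⌋ ⟩
    2 + (⌊ n /2⌋ + ⌊ n /2⌋)            ≤⟨ +-monoʳ-≤ 2 (+-monoʳ-≤ ⌊ n /2⌋ (⌊n/2⌋≤⌈n/2⌉ n)) ⟩
    2 + (⌊ n /2⌋ + ⌈ n /2⌉)            ≡⟨ cong (2 +_) (⌊n/2⌋+⌈n/2⌉≡n n) ⟩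
    2 + n                              ∎
    where
    open ≤-Reasoning
    eq : ∀ x → 2 * suc x ≡ 2 + (x + x)
    eq = solve-∀

  upper : ∀ n (rs : Acc _<_ n) → n < 2 ^ suc (⌊log2⌋ n rs)
  upper 0 _ = s≤s z≤n
  upper 1 _ = s≤s (s≤s z≤n)
  upper (suc (suc n)) (acc rs) = begin
    3 + n                                        ≡⟨ cong (3 +_) (⌊n/2⌋+⌈n/2⌉≡n n) ⟨
    3 + (⌊ n /2⌋ + ⌈ n /2⌉)                      ≤⟨ +-monoʳ-≤ 3 (+-monoʳ-≤ ⌊ n /2⌋
                                                      (⌊n/2⌋-mono (n≤1+n (suc n)))) ⟩
    3 + (⌊ n /2⌋ + suc ⌊ n /2⌋)                  ≡⟨ eq ⌊ n /2⌋ ⟩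
    2 * suc (suc ⌊ n /2⌋)                        ≤⟨ *-monoʳ-≤ 2 (upper (suc ⌊ n /2⌋) _) ⟩
    2 ^ suc (suc (⌊log2⌋ (suc ⌊ n /2⌋) _))       ∎
    where
    open ≤-Reasoning
    eq : ∀ x → 3 + (x + suc x) ≡ 2 * suc (suc x)
    eq = solve-∀

2^⌊log₂⌋≤ : ∀ n → 2 ^ ⌊log₂ suc n ⌋ ≤ suc n
2^⌊log₂⌋≤ n = lower n (<-wellFounded (suc n))

<2^[1+⌊log₂⌋] : ∀ n → n < 2 ^ suc ⌊log₂ n ⌋
<2^[1+⌊log₂⌋] n = upper n (<-wellFounded n)

n<2^n : ∀ n → n < 2 ^ n
n<2^n zero    = s≤s z≤n
n<2^n (suc n) = begin
  2 + n           ≤⟨ +-mono-≤ (m^n>0 2 n) (n<2^n n) ⟩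
  2 ^ n + 2 ^ n   ≡⟨ cong (2 ^ n +_) (+-identityʳ _) ⟨
  2 ^ suc n       ∎
  where open ≤-Reasoning

-- Sizes are bounded by 2^(a·u) with u = 1 + ⌊log₂ n⌋, depths by a·u.
module Bounds (l : ℕ) where
  u : ℕ
  u = suc l

  const-≤ : ∀ c → c ≤ c * u
  const-≤ c = m≤m*n c u

  +-≤ : ∀ {x y} a b → x ≤ a * u → y ≤ b * u → x + y ≤ (a + b) * u
  +-≤ a b p q = ≤-trans (+-mono-≤ p q) (≤-reflexive (sym (*-distribʳ-+ u a b)))

  *-≤ : ∀ {x} c a → x ≤ a * u → c * x ≤ (c * a) * u
  *-≤ c a p = ≤-trans (*-monoʳ-≤ c p) (≤-reflexive (sym (*-assoc c a u)))

  exp-≤ : ∀ {x} a → x ≤ a * u → 2 ^ x ≤ 2 ^ (a * u)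
  exp-≤ a p = ^-monoʳ-≤ 2 p

  linear⇒exp : ∀ {x} a → x ≤ a * u → x ≤ 2 ^ (a * u)
  linear⇒exp a p = ≤-trans p (<⇒≤ (n<2^n (a * u)))

  exp-* : ∀ {x y} a b → x ≤ 2 ^ (a * u) → y ≤ 2 ^ (b * u) → x * y ≤ 2 ^ ((a + b) * u)
  exp-* a b p q = ≤-trans (*-mono-≤ p q) (≤-reflexive
    (trans (sym (^-distribˡ-+-* 2 (a * u) (b * u))) (cong (2 ^_) (sym (*-distribʳ-+ u a b)))))

  exp-+ : ∀ {x y} a → x ≤ 2 ^ (a * u) → y ≤ 2 ^ (a * u) → x + y ≤ 2 ^ (suc a * u)
  exp-+ {x} {y} a p q = begin
    x + y                     ≤⟨ +-mono-≤ p q ⟩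
    2 ^ (a * u) + 2 ^ (a * u) ≡⟨ cong (2 ^ (a * u) +_) (+-identityʳ _) ⟨
    2 ^ (1 + a * u)           ≤⟨ ^-monoʳ-≤ 2 (+-monoˡ-≤ (a * u) {1} {u} (s≤s z≤n)) ⟩
    2 ^ (suc a * u)           ∎
    where open ≤-Reasoning

  exp-suc : ∀ {x} a → x ≤ 2 ^ (a * u) → suc x ≤ 2 ^ (suc a * u)
  exp-suc {x} a p = exp-+ {1} {x} a (m^n>0 2 (a * u)) p

  -- The factor 2 comes from (l + 1)^2 ≤ 2(l^2 + 1).
  square-bound : ∀ {x y} a b → x ≤ a * u → y ≤ b * u →
    x * y ≤ (2 * (a * b)) * l ^ 2 + 2 * (a * b)
  square-bound {x} {y} a b p q = begin
    x * y                                       ≤⟨ *-mono-≤ p q ⟩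
    (a * u) * (b * u)                           ≡⟨ eq₁ a b l ⟩
    (a * b) * (2 * l + (l * l + 1))             ≤⟨ *-monoʳ-≤ (a * b) (+-monoˡ-≤ (l * l + 1) (2l≤l²+1 l)) ⟩
    (a * b) * ((l * l + 1) + (l * l + 1))       ≡⟨ eq₂ (a * b) l ⟩
    (2 * (a * b)) * l ^ 2 + 2 * (a * b)         ∎
    where
    open ≤-Reasoning
    eq₁ : ∀ a b l → (a * suc l) * (b * suc l) ≡ (a * b) * (2 * l + (l * l + 1))
    eq₁ = solve-∀
    eq₂ : ∀ c l → c * ((l * l + 1) + (l * l + 1)) ≡ (2 * c) * (l * (l * 1)) + 2 * c
    eq₂ = solve-∀
    2l≤l²+1 : ∀ l → 2 * l ≤ l * l + 1
    2l≤l²+1 zero    = z≤n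
    2l≤l²+1 (suc l) = ≤-trans (m≤n+m (2 * suc l) (l * l)) (≤-reflexive (eq₃ l))
      where
      eq₃ : ∀ l → l * l + 2 * suc l ≡ suc l * suc l + 1
      eq₃ = solve-∀

-- `PolyBounded` uses one number as coefficient, exponent and summand, so the exponent `a` is
-- enlarged to `2 ^ a`. At `n = 0` the summand alone gives the bound.
exp⇒poly : ∀ a n → 2 ^ (a * suc ⌊log₂ n ⌋) ≤ 2 ^ a * n ^ (2 ^ a) + 2 ^ a
exp⇒poly a zero    = ≤-trans (≤-reflexive (cong (2 ^_) (*-identityʳ a))) (m≤n+m _ _)
exp⇒poly a n@(suc n-1) = begin
  2 ^ (a * suc ⌊log₂ n ⌋)      ≡⟨ cong (2 ^_) (trans (*-suc a _) (cong (a +_) (*-comm a _))) ⟩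
  2 ^ (a + ⌊log₂ n ⌋ * a)      ≡⟨ ^-distribˡ-+-* 2 a _ ⟩
  2 ^ a * 2 ^ (⌊log₂ n ⌋ * a)  ≡⟨ cong (2 ^ a *_) (^-*-assoc 2 ⌊log₂ n ⌋ a) ⟨
  2 ^ a * (2 ^ ⌊log₂ n ⌋) ^ a  ≤⟨ *-monoʳ-≤ (2 ^ a) (^-monoˡ-≤ a (2^⌊log₂⌋≤ n-1)) ⟩
  2 ^ a * n ^ a                ≤⟨ *-monoʳ-≤ (2 ^ a) (^-monoʳ-≤ n (<⇒≤ (n<2^n a))) ⟩
  2 ^ a * n ^ (2 ^ a)          ≤⟨ m≤m+n _ _ ⟩
  2 ^ a * n ^ (2 ^ a) + 2 ^ a  ∎
  where open ≤-Reasoning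

-- From `n < 2 ^ u`: the power and the coefficient each cost `c * u` in the exponent, the final sum
-- one more `u`.
poly⇒exp : ∀ c n → c * n ^ c + c ≤ 2 ^ (suc (c + c) * suc ⌊log₂ n ⌋)
poly⇒exp c n = exp-+ (c + c)
  (exp-* c c c≤ (≤-trans (^-monoˡ-≤ c (<⇒≤ (<2^[1+⌊log₂⌋] n)))
    (≤-reflexive (trans (^-*-assoc 2 u c) (cong (2 ^_) (*-comm u c))))))
  (≤-trans c≤ (exp-≤ (c + c) (*-monoˡ-≤ u (m≤m+n c c))))
  where
  open Bounds ⌊log₂ n ⌋
  c≤ : c ≤ 2 ^ (c * u)
  c≤ = linear⇒exp c (const-≤ c)

mainTheorem6 : (𝔸 : FinAlgebra) → IsMalcev 𝔸 → IsSolvable 𝔸 →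
    (L : Language) → nuP 𝔸 L → NC2 L
mainTheorem6 𝔸 malcev solvable L (s , t , ι , S , (c , s≤) , recognises) =
  _ , Sim.result ,
  (2 ^ sizeCoeff , λ n → ≤-trans (size-bound n) (exp⇒poly sizeCoeff n)) ,
  (2 * (countCoeff * depthCoeff) , λ n → ≤-trans (Sim.result-depth n)
    (Bounds.square-bound ⌊log₂ n ⌋ countCoeff depthCoeff (count-bound n) (depth-bound n))) ,
  λ n b →
    (λ b∈L → trans (Sim.result-correct n _) ([]=⇒lookup (proj₁ (recognises n b) b∈L))) ,
    (λ out → proj₂ (recognises n b) (lookup⇒[]= _ S (trans (sym (Sim.result-correct n _)) out)))
  where
  open FinAlgebra 𝔸 using (arity) renaming (size to q)
  κ K R : ℕ
  κ = suc (c + c)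
  K = proj₁ solvable
  R = proj₁ (maximum arity)

  -- Trees must have room for `suc (s n)` leaves; `κ` is the coefficient in `poly⇒exp`, so the
  -- height is logarithmic.
  height : ℕ → ℕ
  height n = κ * suc ⌊log₂ n ⌋

  s<2^h : ∀ n → suc (s n) ≤ 2 ^ height n
  s<2^h n = ≤-trans (s≤ n) (poly⇒exp c n)

  module Sim (n : ℕ) = Simulation.Compiled 𝔸 malcev solvable ι S (t n) (height n) (s<2^h n)

  countCoeff depthCoeff wordCoeff sizeCoeff : ℕ
  -- The first two mirror the quantities they bound, with `κ` in place of the height. The other two
  -- are exponents: they add where sizes multiply.
  countCoeff = 2 + (K * (1 + κ) + 1)
  depthCoeff = 1 + ((R * suc q + 3) + (3 * suc q * κ + suc q))
  wordCoeff  = suc (κ + (suc (κ + q) + q))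
  sizeCoeff  = countCoeff + (wordCoeff + depthCoeff)

  module _ (n : ℕ) where
    open Bounds ⌊log₂ n ⌋

    count-bound : 2 + Sim.layerCount n K ≤ countCoeff * u
    count-bound = +-≤ {2} 2 (K * (1 + κ) + 1) (const-≤ 2)
      (+-≤ (K * (1 + κ)) 1 (*-≤ K (1 + κ) (+-≤ {1} 1 κ (const-≤ 1) ≤-refl)) (const-≤ 1))

    depth-bound : suc (Sim.layerDepth n) ≤ depthCoeff * u
    depth-bound = +-≤ {1} 1 (R * suc q + 3 + (3 * suc q * κ + suc q)) (const-≤ 1)
      (+-≤ (R * suc q + 3) (3 * suc q * κ + suc q) (const-≤ (R * suc q + 3))
      (+-≤ (3 * suc q * κ) (suc q)
        (≤-trans (≤-reflexive (*-comm (height n) (3 * suc q))) (*-≤ (3 * suc q) κ ≤-refl))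
        (const-≤ (suc q))))

    word-bound : suc (Sim.wordSize n) ≤ 2 ^ (wordCoeff * u)
    word-bound = exp-suc {Sim.wordSize n} (κ + (suc (κ + q) + q))
      (exp-* κ (suc (κ + q) + q) (s<2^h n)
      (exp-* (suc (κ + q)) q (exp-suc (κ + q) (exp-* κ q (s<2^h n) q≤)) q≤))
      where
      q≤ : q ≤ 2 ^ (q * u)
      q≤ = linear⇒exp q (const-≤ q)

    size-bound : _ ≤ 2 ^ (sizeCoeff * u)
    size-bound = ≤-trans (Sim.result-size n)
      (exp-* countCoeff (wordCoeff + depthCoeff) (linear⇒exp countCoeff count-bound)
        (exp-* wordCoeff depthCoeff word-bound (exp-≤ depthCoeff depth-bound)))
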